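{- For all integers $w\ge 3$ and $m$ with $w\le m\le 3w$, we have $\nu(m,w)=2m-w$.
   Context: For $y \in \{0,1\}^n$, $\mathrm{wt}(y)$ is the number of nonzero coordinates, and $\mathcal{B}(n,w)=\{y\in\{0,1\}^n : \mathrm{wt}(y)\le w\}$. A domination graph is a bipartite graph $G=([m]\cup[n],E)$ with left vertex set $[m]$ and right vertex set $[n]$ having no isolated right vertices. An injective map $\varphi:\{0,1\}^m\to\mathcal{B}(n,w)$ is $G$-dominating if for every $x\in\{0,1\}^m$ and every edge $(i,j)\in E$: $x_i=0$ implies that the $j$-th coordinate of $\varphi(x)$ is $0$. An $(m,n,w)$-domination mapping is an injective map $\{0,1\}^m\to\mathcal{B}(n,w)$ that is $G$-dominating for some domination graph $G=([m]\cup[n],E)$. $\nu(m,w)$ denotes the minimum integer $n$ such that an $(m,n,w)$-domination mapping exists. -}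

module Defs where

open import Data.Nat using (ℕ; zero; suc; _≤_)
open import Data.Bool using (Bool; true; false)
open import Data.Fin using (Fin)
open import Data.Vec using (Vec; []; _∷_; lookup)
open import Data.Product using (Σ; ∃; _×_)
open import Function.Definitions using (Injective)
open import Relation.Binary.PropositionalEquality using (_≡_)

Word : ℕ → Set
Word n = Vec Bool n

wt : ∀ {n} → Word n → ℕ
wt []           = 0
wt (true  ∷ y)  = suc (wt y)
wt (false ∷ y)  = wt y

BipGraph : ℕ → ℕ → Set
BipGraph m n = Fin m → Fin n → Bool

IsDominationGraph : ∀ {m n} → BipGraph m n → Set
IsDominationGraph {m} {n} E = ∀ (j : Fin n) → ∃ λ (i : Fin m) → E i j ≡ true

IsDominating : ∀ {m n} → BipGraph m n → (Word m → Word n) → Set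
IsDominating {m} {n} E φ =
  ∀ (x : Word m) (i : Fin m) (j : Fin n) →
    E i j ≡ true → lookup x i ≡ false → lookup (φ x) j ≡ false

DominationMapping : ℕ → ℕ → ℕ → Set
DominationMapping m n w =
  Σ (Word m → Word n) λ φ →
    Injective _≡_ _≡_ φ ×
    (∀ x → wt (φ x) ≤ w) ×
    Σ (BipGraph m n) λ E → IsDominationGraph E × IsDominating E φ

IsNu : ℕ → ℕ → ℕ → Set
IsNu m w k = DominationMapping m k w × (∀ n → DominationMapping m n w → k ≤ n)

-- Domination only matters through one left neighbour f j of each right vertex j, so a graph amounts to
-- the degrees of its left vertices.
--
-- Lower bound: let S be the set of left vertices of degree at most 1 and N its neighbourhood, so |N| ≤ |S|.
-- The 2^|S| words supported on S map injectively to words of weight at most w supported on N, which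
-- forces |S| = |N| ≤ w.  The other left vertices have degree at least 2, so n ≥ |N| + 2 (m − |S|) ≥ 2m − w.
--
-- Existence: take w left vertices of degree 1 and d of degree 2.  Dropping a vertex of degree 2 and
-- placing two mappings side by side reduce everything to d = 2w with w = 3, 4, 5.  For w = 3 a table is
-- given.  For w = 4, 5 the word is split in two.  The left part is coded either with weight at most 3, or
-- with weight at most 2 together with a label in Fin 5; the right part is coded by a single light word in the
-- first case and by five heavier ones, selected by the label, in the second.

module Submission where

open import Defs
open import Data.Nat using (ℕ; zero; suc; _≤_; _≤′_; ≤′-refl; ≤′-step; _*_; _+_; _∸_; _^_; _/_; _%_; _≡ᵇ_; _≤ᵇ_; _≤?_; z≤n; s≤s; NonZero)
open import Data.Nat.Properties
open import Data.Nat.DivMod using (_mod_)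
open import Data.Nat.Tactic.RingSolver using (solve-∀)
open import Data.Bool using (Bool; true; false; _∨_; if_then_else_; f≤t; b≤b) renaming (_≤_ to _≤ᴮ_)
import Data.Bool.Properties as Bool
open import Data.Fin using (Fin; zero; suc; toℕ; combine)
import Data.Fin.Properties as Fin
open import Data.Vec using (Vec; []; _∷_; _++_; head; tail; lookup; map; take; drop; replicate; tabulate; allFin)
open import Data.Vec.Properties using (≡-dec; ++-injective; take++drop≡id; map-++; take-map; drop-map; map-lookup-allFin; lookup-map; lookup∘tabulate)
open import Data.Vec.Relation.Binary.Pointwise.Inductive using (Pointwise; []; _∷_; ++⁺; decidable)
import Data.Vec.Relation.Binary.Pointwise.Inductive as Pointwise
open import Data.List using (List; []; _∷_)
open import Data.Product using (_×_; _,_; proj₁; proj₂)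
import Data.Product.Properties as Product
open import Algebra.Properties.Semiring.Sum +-*-semiring using (sum; sum-syntax; ∑-comm; ∑-distrib-+; sum-cong-≗; *-distribʳ-sum)
open import Function using (_∘_)
open import Function.Definitions using (Injective)
open import Relation.Nullary using (¬_; Dec; yes; does; contradiction)
open import Relation.Nullary.Decidable using (map′; _×-dec_; _→-dec_; dec-true)
open import Relation.Binary.PropositionalEquality
open import Relation.Binary.Definitions using (DecidableEquality)

-- Coordinatewise order and weight of words

infix 4 _⊑_ _◁_

_⊑_ : ∀ {n} → Word n → Word n → Set
_⊑_ = Pointwise _≤ᴮ_

_⊑?_ : ∀ {n} (x y : Word n) → Dec (x ⊑ y)
_⊑?_ = decidable Bool._≤?_

⊑⇒lookup : ∀ {n} {y x : Word n} → y ⊑ x → ∀ j → lookup x j ≡ false → lookup y j ≡ false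
⊑⇒lookup {y = y} {x} y⊑x j xj≡0 with lookup y j | lookup x j | Pointwise.lookup y⊑x j
... | false | false | b≤b = refl

lookup⇒⊑ : ∀ {n} {y x : Word n} → (∀ j → lookup x j ≡ false → lookup y j ≡ false) → y ⊑ x
lookup⇒⊑ {y = []}        {[]}        h = []
lookup⇒⊑ {y = false ∷ _} {false ∷ _} h = b≤b ∷ lookup⇒⊑ (h ∘ suc)
lookup⇒⊑ {y = false ∷ _} {true  ∷ _} h = f≤t ∷ lookup⇒⊑ (h ∘ suc)
lookup⇒⊑ {y = true  ∷ _} {true  ∷ _} h = b≤b ∷ lookup⇒⊑ (h ∘ suc)
lookup⇒⊑ {y = true  ∷ _} {false ∷ _} h with () ← h zero refl

wt-++ : ∀ {m n} (x : Word m) (y : Word n) → wt (x ++ y) ≡ wt x + wt y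
wt-++ []          y = refl
wt-++ (true  ∷ x) y = cong suc (wt-++ x y)
wt-++ (false ∷ x) y = wt-++ x y

wt-mono-⊑ : ∀ {n} {x y : Word n} → x ⊑ y → wt x ≤ wt y
wt-mono-⊑ []                        = z≤n
wt-mono-⊑ (f≤t ∷ p)                 = m≤n⇒m≤1+n (wt-mono-⊑ p)
wt-mono-⊑ {x = true  ∷ _} (b≤b ∷ p) = s≤s (wt-mono-⊑ p)
wt-mono-⊑ {x = false ∷ _} (b≤b ∷ p) = wt-mono-⊑ p

take-drop-injective : ∀ {A : Set} m {n} (x y : Vec A (m + n)) → take m x ≡ take m y → drop m x ≡ drop m y → x ≡ y
take-drop-injective m x y p q =
  trans (sym (take++drop≡id m x)) (trans (cong₂ _++_ p q) (take++drop≡id m y))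

-- Lower bound

bit : Bool → Fin 2
bit false = zero
bit true  = suc zero

bit-injective : Injective _≡_ _≡_ bit
bit-injective {false} {false} _ = refl
bit-injective {true}  {true}  _ = refl

-- Only injectivity matters: it transfers to words the fact that `ℕ` does not embed in a finite set.
wordToFin : ∀ {k} → Word k → Fin (2 ^ k)
wordToFin []      = zero
wordToFin (b ∷ x) = combine (bit b) (wordToFin x)

wordToFin-injective : ∀ {k} → Injective _≡_ _≡_ (wordToFin {k})
wordToFin-injective {x = []}    {[]}    _  = refl
wordToFin-injective {x = b ∷ x} {c ∷ y} eq
  with b≡c , x≡y ← Fin.combine-injective (bit b) (wordToFin x) (bit c) (wordToFin y) eq
  = cong₂ _∷_ (bit-injective b≡c) (wordToFin-injective x≡y)

-- The orbit of a word outside the image would be an infinite injective sequence of words.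
injective⇒hits : ∀ {k} (f : Word k → Word k) → Injective _≡_ _≡_ f → ∀ c → ¬ (∀ x → f x ≢ c)
injective⇒hits {k} f f-inj c missed =
  Fin.ℕ→Fin-notInjective (wordToFin ∘ orbit) (orbit-injective ∘ wordToFin-injective)
  where
  orbit : ℕ → Word k
  orbit zero    = c
  orbit (suc i) = f (orbit i)

  orbit-injective : Injective _≡_ _≡_ orbit
  orbit-injective {zero}  {zero}  _  = refl
  orbit-injective {zero}  {suc j} eq = contradiction (sym eq) (missed (orbit j))
  orbit-injective {suc i} {zero}  eq = contradiction eq (missed (orbit i))
  orbit-injective {suc i} {suc j} eq = cong suc (orbit-injective (f-inj eq))

-- Parametrises the subcube of words below `S` by a full cube of dimension `wt S`.
expand : ∀ {n} (S : Word n) → Word (wt S) → Word n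
expand []          _       = []
expand (true  ∷ S) (b ∷ x) = b ∷ expand S x
expand (false ∷ S) x       = false ∷ expand S x

expand-⊑ : ∀ {n} (S : Word n) x → expand S x ⊑ S
expand-⊑ []          _           = []
expand-⊑ (true  ∷ S) (true  ∷ x) = b≤b ∷ expand-⊑ S x
expand-⊑ (true  ∷ S) (false ∷ x) = f≤t ∷ expand-⊑ S x
expand-⊑ (false ∷ S) x           = b≤b ∷ expand-⊑ S x

expand-injective : ∀ {n} (S : Word n) → Injective _≡_ _≡_ (expand S)
expand-injective []          {[]}    {[]}    _  = refl
expand-injective (true  ∷ S) {b ∷ x} {c ∷ y} eq =
  cong₂ _∷_ (cong head eq) (expand-injective S (cong tail eq))
expand-injective (false ∷ S) eq = expand-injective S (cong tail eq)

-- Padding with zeros up to length `k` lets `subcube-bound` take `k = wt S`, so that a map between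
-- two subcubes becomes a self-map of one cube.
compress : ∀ {n k} (N : Word n) → wt N ≤ k → Word n → Word k
compress []          _       _       = replicate _ false
compress (true  ∷ N) (s≤s p) (b ∷ y) = b ∷ compress N p y
compress (false ∷ N) p       (_ ∷ y) = compress N p y

compress-injective : ∀ {n k} (N : Word n) (p : wt N ≤ k) {y z} → y ⊑ N → z ⊑ N →
                     compress N p y ≡ compress N p z → y ≡ z
compress-injective []          p       []        []        _  = refl
compress-injective (true  ∷ N) (s≤s p) (_ ∷ y⊑N) (_ ∷ z⊑N) eq =
  cong₂ _∷_ (cong head eq) (compress-injective N p y⊑N z⊑N (cong tail eq))
compress-injective (false ∷ N) p       (b≤b ∷ y⊑N) (b≤b ∷ z⊑N) eq =
  cong (false ∷_) (compress-injective N p y⊑N z⊑N eq)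

wt-zeros : ∀ k → wt (replicate k false) ≡ 0
wt-zeros zero    = refl
wt-zeros (suc k) = wt-zeros k

wt-ones : ∀ k → wt (replicate k true) ≡ k
wt-ones zero    = refl
wt-ones (suc k) = cong suc (wt-ones k)

wt-compress : ∀ {n k} (N : Word n) (p : wt N ≤ k) y → wt (compress N p y) ≤ wt y
wt-compress {k = k} [] _ [] = ≤-reflexive (wt-zeros k)
wt-compress (true  ∷ N) (s≤s p) (true  ∷ y) = s≤s (wt-compress N p y)
wt-compress (true  ∷ N) (s≤s p) (false ∷ y) = wt-compress N p y
wt-compress (false ∷ N) p       (true  ∷ y) = m≤n⇒m≤1+n (wt-compress N p y)
wt-compress (false ∷ N) p       (false ∷ y) = wt-compress N p y

-- Restricting `φ` to the words below `S` and compressing the images gives an injective self-map of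
-- a cube of dimension `wt S`. It must hit the all-ones word, of weight `wt S`, although no image
-- weighs more than `w`.
subcube-bound : ∀ {m n w} (φ : Word m → Word n) → Injective _≡_ _≡_ φ →
                (S : Word m) (N : Word n) → (∀ x → x ⊑ S → φ x ⊑ N) →
                (∀ x → x ⊑ S → wt (φ x) ≤ w) → wt N ≤ wt S → wt S ≤ w
subcube-bound {w = w} φ φ-inj S N S⇒N S-wt N≤S = ≮⇒≥ λ w<S →
  injective⇒hits χ χ-injective (replicate _ true) λ x hit →
    <⇒≱ w<S (≤-trans (≤-reflexive (sym (trans (cong wt hit) (wt-ones (wt S))))) (χ-wt x))
  where
  χ : Word (wt S) → Word (wt S)
  χ x = compress N N≤S (φ (expand S x))

  image-⊑ : ∀ x → φ (expand S x) ⊑ N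
  image-⊑ x = S⇒N _ (expand-⊑ S x)

  χ-injective : Injective _≡_ _≡_ χ
  χ-injective eq = expand-injective S (φ-inj (compress-injective N N≤S (image-⊑ _) (image-⊑ _) eq))

  χ-wt : ∀ x → wt (χ x) ≤ w
  χ-wt x = ≤-trans (wt-compress N N≤S _) (S-wt _ (expand-⊑ S x))

-- Double counting along the fibres of a neighbour map

indicator : Bool → ℕ
indicator b = if b then 1 else 0

wt-tabulate : ∀ {n} (p : Fin n → Bool) → wt (tabulate p) ≡ ∑[ j < n ] indicator (p j)
wt-tabulate {zero}  p = refl
wt-tabulate {suc n} p with p zero
... | true  = cong suc (wt-tabulate (p ∘ suc))
... | false = wt-tabulate (p ∘ suc)

sum-mono-≤ : ∀ {n} {g h : Fin n → ℕ} → (∀ i → g i ≤ h i) → sum g ≤ sum h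
sum-mono-≤ {zero}  g≤h = z≤n
sum-mono-≤ {suc n} g≤h = +-mono-≤ (g≤h zero) (sum-mono-≤ (g≤h ∘ suc))

sum-const : ∀ n c → (∑[ i < n ] c) ≡ n * c
sum-const zero    c = refl
sum-const (suc n) c = cong (c +_) (sum-const n c)

sum-zero : ∀ n → (∑[ i < n ] 0) ≡ 0
sum-zero n = trans (sum-const n 0) (*-zeroʳ n)

sum-kronecker : ∀ {m} (a : Fin m) (g : Fin m → ℕ) →
                (∑[ i < m ] (indicator (does (a Fin.≟ i)) * g i)) ≡ g a
sum-kronecker {suc m} zero    g = trans (cong₂ _+_ (*-identityˡ (g zero)) (sum-zero m)) (+-identityʳ (g zero))
sum-kronecker {suc m} (suc a) g = sum-kronecker a (g ∘ suc)

fibre : ∀ {m n} → (Fin n → Fin m) → Fin m → ℕ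
fibre {n = n} f i = ∑[ j < n ] indicator (does (f j Fin.≟ i))

sum-over-fibres : ∀ {m n} (f : Fin n → Fin m) (g : Fin m → ℕ) →
                  (∑[ j < n ] g (f j)) ≡ (∑[ i < m ] (fibre f i * g i))
sum-over-fibres {m} {n} f g = begin
  (∑[ j < n ] g (f j))                                                ≡⟨ sum-cong-≗ (λ j → sum-kronecker (f j) g) ⟨
  (∑[ j < n ] ∑[ i < m ] (indicator (does (f j Fin.≟ i)) * g i))      ≡⟨ ∑-comm (λ j i → indicator (does (f j Fin.≟ i)) * g i) ⟩
  (∑[ i < m ] ∑[ j < n ] (indicator (does (f j Fin.≟ i)) * g i))      ≡⟨ sum-cong-≗ (λ i → *-distribʳ-sum (g i) (λ j → indicator (does (f j Fin.≟ i)))) ⟨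
  (∑[ i < m ] (fibre f i * g i))                                      ∎
  where open ≡-Reasoning

-- Written without subtraction, the count is 2m + |S| ≤ 2m + |N| ≤ n + 2|S| ≤ n + w + |S|, after
-- which |S| cancels. The middle inequality is `big-or-small` summed over the left vertices.
lower-bound : ∀ {m n w} → DominationMapping m n w → m + m ≤ n + w
lower-bound {m} {n} {w} (φ , φ-inj , φ-wt , E , no-isolated , dominating) =
  +-cancelʳ-≤ (wt S) (m + m) (n + w) (begin
    m + m + wt S                ≤⟨ +-monoʳ-≤ (m + m) S≤N ⟩
    m + m + wt N                ≡⟨ cong₂ _+_ (trans (m+m≡m*2 m) (sym (sum-const m 2))) N-count ⟩
    (∑[ i < m ] 2) + (∑[ i < m ] (deg i * small i))
                                ≡⟨ ∑-distrib-+ (λ _ → 2) (λ i → deg i * small i) ⟨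
    (∑[ i < m ] (2 + deg i * small i))
                                ≤⟨ sum-mono-≤ big-or-small ⟩
    (∑[ i < m ] (deg i * 1 + small i * 2))
                                ≡⟨ ∑-distrib-+ (λ i → deg i * 1) (λ i → small i * 2) ⟩
    (∑[ i < m ] (deg i * 1)) + (∑[ i < m ] (small i * 2))
                                ≡⟨ cong₂ _+_ (sum-over-fibres f (λ _ → 1)) (*-distribʳ-sum 2 small) ⟨
    (∑[ j < n ] 1) + sum small * 2
                                ≡⟨ cong₂ (λ a b → a + b * 2) (trans (sum-const n 1) (*-identityʳ n)) (sym (wt-tabulate isSmall)) ⟩
    n + wt S * 2                ≡⟨ regroup n (wt S) ⟩
    n + wt S + wt S             ≤⟨ +-monoˡ-≤ (wt S) (+-monoʳ-≤ n S≤w) ⟩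
    n + w + wt S                ∎)
  where
  open ≤-Reasoning
  m+m≡m*2 : ∀ a → a + a ≡ a * 2
  m+m≡m*2 = solve-∀
  regroup : ∀ a b → a + b * 2 ≡ a + b + b
  regroup = solve-∀

  f : Fin n → Fin m
  f j = proj₁ (no-isolated j)

  deg : Fin m → ℕ
  deg = fibre f

  isSmall : Fin m → Bool
  isSmall i = deg i ≤ᵇ 1

  small : Fin m → ℕ
  small = indicator ∘ isSmall

  S : Word m
  S = tabulate isSmall

  N : Word n
  N = tabulate (isSmall ∘ f)
  N-count : wt N ≡ (∑[ i < m ] (deg i * small i))
  N-count = trans (wt-tabulate (isSmall ∘ f)) (sum-over-fibres f small)

  N≤S : wt N ≤ wt S
  N≤S = ≤-trans (≤-reflexive N-count) (≤-trans (sum-mono-≤ deg-small) (≤-reflexive (sym (wt-tabulate isSmall))))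
    where
    deg-small : ∀ i → deg i * small i ≤ small i
    deg-small i with deg i
    ... | 0 = z≤n
    ... | 1 = ≤-refl
    ... | suc (suc d) = ≤-reflexive (*-zeroʳ d)

  -- Equality holds in degrees 0, 1 and 2; every further neighbour only increases the right side.
  big-or-small : ∀ i → 2 + deg i * small i ≤ deg i * 1 + small i * 2
  big-or-small i with deg i
  ... | 0 = ≤-refl
  ... | 1 = ≤-refl
  ... | suc (suc d) = s≤s (s≤s (≤-trans (≤-reflexive (*-zeroʳ d)) z≤n))

  -- If `j` lies outside `N`, then `f j` lies outside `S`, so `x` vanishes at `f j` and domination
  -- makes `φ x` vanish at `j`.
  S⇒N : ∀ x → x ⊑ S → φ x ⊑ N
  S⇒N x x⊑S = lookup⇒⊑ λ j Nj≡0 →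
    dominating x (f j) j (proj₂ (no-isolated j))
      (⊑⇒lookup x⊑S (f j) (trans (lookup∘tabulate isSmall (f j)) (trans (sym (lookup∘tabulate (isSmall ∘ f) j)) Nj≡0)))

  S≤w : wt S ≤ w
  S≤w = subcube-bound φ φ-inj S N S⇒N (λ x _ → φ-wt x) N≤S

  -- The same bound with `wt N` in place of `w`: images below `N` weigh at most `wt N`.
  S≤N : wt S ≤ wt N
  S≤N = subcube-bound φ φ-inj S N S⇒N (λ x → wt-mono-⊑ ∘ S⇒N x) N≤S

-- Constructions

-- A left vertex carrying a bit of the second component of an input has degree 2; its two right
-- neighbours carry the corresponding bits of the last two components of an output.

Input : ℕ → ℕ → Set
Input w d = Word w × Word d

Output : ℕ → ℕ → Set
Output w d = Word w × Word d × Word d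

weight : ∀ {w d} → Output w d → ℕ
weight (a , b , c) = wt a + (wt b + wt c)

_◁_ : ∀ {w d} → Output w d → Input w d → Set
(a , b , c) ◁ (x , y) = a ⊑ x × b ⊑ y × c ⊑ y

-- A word may serve up to `k` inputs, told apart by their labels; for `k = 1` the words alone are
-- injective. The weight bound `t` is kept separate from `w` so that a tighter bound can be paid for
-- with labels.
record Coding (w d t k : ℕ) : Set where
  field
    code      : Input w d → Output w d × Fin k
    injective : Injective _≡_ _≡_ code
    dominated : ∀ x → proj₁ (code x) ◁ x
    bounded   : ∀ x → weight (proj₁ (code x)) ≤ t

open Coding

-- Placing codings side by side and dropping vertices of degree 2

Fin₁-unique : (i j : Fin 1) → i ≡ j
Fin₁-unique zero zero = refl

juxtapose : ∀ {w₁ d₁ w₂ d₂} → Output w₁ d₁ → Output w₂ d₂ → Output (w₁ + w₂) (d₁ + d₂)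
juxtapose (a , b , c) (a′ , b′ , c′) = a ++ a′ , b ++ b′ , c ++ c′

juxtapose-injective : ∀ {w₁ d₁ w₂ d₂} (z z′ : Output w₁ d₁) {u u′ : Output w₂ d₂} →
                      juxtapose z u ≡ juxtapose z′ u′ → z ≡ z′ × u ≡ u′
juxtapose-injective (a , b , c) (a′ , b′ , c′) eq
  with refl , refl ← ++-injective a a′ (cong proj₁ eq)
     | refl , refl ← ++-injective b b′ (cong (proj₁ ∘ proj₂) eq)
     | refl , refl ← ++-injective c c′ (cong (proj₂ ∘ proj₂) eq)
  = refl , refl

weight-juxtapose : ∀ {w₁ d₁ w₂ d₂} (z : Output w₁ d₁) (u : Output w₂ d₂) →
                   weight (juxtapose z u) ≡ weight z + weight u
weight-juxtapose (a , b , c) (a′ , b′ , c′)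
  rewrite wt-++ a a′ | wt-++ b b′ | wt-++ c c′ = regroup (wt a) (wt b) (wt c) (wt a′) (wt b′) (wt c′)
  where
  regroup : ∀ a b c a′ b′ c′ → a + a′ + (b + b′ + (c + c′)) ≡ a + (b + c) + (a′ + (b′ + c′))
  regroup = solve-∀

⊑-++ : ∀ m {n} {y : Word m} {y′ : Word n} (x : Word (m + n)) → y ⊑ take m x → y′ ⊑ drop m x → y ++ y′ ⊑ x
⊑-++ m {y = y} {y′} x p p′ = subst (y ++ y′ ⊑_) (take++drop≡id m x) (++⁺ p p′)

module _ (w₁ d₁ : ℕ) {w₂ d₂ : ℕ} where

  left : Input (w₁ + w₂) (d₁ + d₂) → Input w₁ d₁
  left (x , y) = take w₁ x , take d₁ y

  right : Input (w₁ + w₂) (d₁ + d₂) → Input w₂ d₂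
  right (x , y) = drop w₁ x , drop d₁ y

  left-right-injective : ∀ x y → left x ≡ left y → right x ≡ right y → x ≡ y
  left-right-injective (x , y) (x′ , y′) p q = cong₂ _,_
    (take-drop-injective w₁ x x′ (cong proj₁ p) (cong proj₁ q))
    (take-drop-injective d₁ y y′ (cong proj₂ p) (cong proj₂ q))

-- The word representing y is selected among the u y k by the label with which the left part is coded.
amalgamate : ∀ {w₁ d₁ w₂ d₂ t} (s m : Input w₂ d₂ → ℕ) (u : ∀ y → Fin (m y) → Output w₂ d₂) →
             (∀ y → Coding w₁ d₁ (s y) (m y)) →
             (∀ {y y′ k k′} → u y k ≡ u y′ k′ → (y , k) ≡ (y′ , k′)) →
             (∀ y k → u y k ◁ y) →
             (∀ y k → s y + weight (u y k) ≤ t) →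
             Coding (w₁ + w₂) (d₁ + d₂) t 1
amalgamate {w₁} {d₁} {w₂} {d₂} {t} s m u γ u-injective u-dominated u-bounded = record
  { code      = λ x → combined (left w₁ d₁ x) (right w₁ d₁ x) , zero
  ; injective = λ {x} {x′} eq →
      let p , q = combined-injective (cong proj₁ eq) in left-right-injective w₁ d₁ x x′ p q
  ; dominated = combined-dominated
  ; bounded   = λ x → combined-bounded (left w₁ d₁ x) (right w₁ d₁ x)
  }
  where
  combined : Input w₁ d₁ → Input w₂ d₂ → Output (w₁ + w₂) (d₁ + d₂)
  combined x y = let z , k = code (γ y) x in juxtapose z (u y k)

  combined-injective : ∀ {x x′ y y′} → combined x y ≡ combined x′ y′ → x ≡ x′ × y ≡ y′
  combined-injective {x} {x′} {y} {y′} eq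
    with code (γ y) x in p | code (γ y′) x′ in q
  ... | z , k | z′ , k′
    -- Decoding goes from right to left: the right word reveals both `y` and the label, and the
    -- label together with the left word determines the left input under `γ y`.
    with z≡z′ , u≡u′ ← juxtapose-injective z z′ eq
    with refl ← z≡z′ | refl ← u-injective u≡u′
    = injective (γ y) (trans p (sym q)) , refl

  combined-dominated : ∀ x → combined (left w₁ d₁ x) (right w₁ d₁ x) ◁ x
  combined-dominated x@(a , b) =
    let y = right w₁ d₁ x
        _ , k = code (γ y) (left w₁ d₁ x)
        p , q , r = dominated (γ y) (left w₁ d₁ x)
        p′ , q′ , r′ = u-dominated y k
    in ⊑-++ w₁ a p p′ , ⊑-++ d₁ b q q′ , ⊑-++ d₁ b r r′

  combined-bounded : ∀ x y → weight (combined x y) ≤ t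
  combined-bounded x y = let z , k = code (γ y) x in begin
    weight (juxtapose z (u y k)) ≡⟨ weight-juxtapose z (u y k) ⟩
    weight z + weight (u y k)    ≤⟨ +-monoˡ-≤ _ (bounded (γ y) x) ⟩
    s y + weight (u y k)         ≤⟨ u-bounded y k ⟩
    t                            ∎
    where open ≤-Reasoning

-- The case of `amalgamate` with a constant budget and one word per right part.
product : ∀ {w₁ d₁ t₁ w₂ d₂ t₂} → Coding w₁ d₁ t₁ 1 → Coding w₂ d₂ t₂ 1 → Coding (w₁ + w₂) (d₁ + d₂) (t₁ + t₂) 1
product {t₁ = t₁} α β = amalgamate (λ _ → t₁) (λ _ → 1) (λ y _ → proj₁ (code β y)) (λ _ → α)
  β-injective (λ y _ → dominated β y) (λ y _ → +-monoʳ-≤ t₁ (bounded β y))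
  where
  β-injective : ∀ {y y′} {k k′ : Fin 1} → proj₁ (code β y) ≡ proj₁ (code β y′) → (y , k) ≡ (y′ , k′)
  β-injective {k = zero} {zero} eq = cong (_, zero) (injective β (cong₂ _,_ eq (Fin₁-unique _ _)))

-- Fixing one doubled bit to zero forces its two output bits to zero by domination, so deleting them
-- loses no information.
shorten : ∀ {w d t} → Coding w (suc d) t 1 → Coding w d t 1
shorten {w} {d} α = record
  { code      = λ x → let (a , b , c) , k = code α (extend x) in (a , tail b , tail c) , k
  ; injective = λ {x} {x′} eq → extend-injective (injective α
      (restore (code α (extend x)) (code α (extend x′)) (dominated α (extend x)) (dominated α (extend x′)) eq))
  ; dominated = λ x → let p , q , r = dominated α (extend x) in p , tail-⊑ q , tail-⊑ r
  ; bounded   = λ x → let (a , b , c) , _ = code α (extend x) in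
      ≤-trans (+-monoʳ-≤ (wt a) (+-mono-≤ (wt-tail b) (wt-tail c))) (bounded α (extend x))
  }
  where
  extend : Input w d → Input w (suc d)
  extend (x , y) = x , false ∷ y

  extend-injective : Injective _≡_ _≡_ extend
  extend-injective refl = refl

  tail-⊑ : ∀ {n} {y : Word (suc n)} {b x} → y ⊑ b ∷ x → tail y ⊑ x
  tail-⊑ (_ ∷ p) = p

  wt-tail : ∀ {n} (y : Word (suc n)) → wt (tail y) ≤ wt y
  wt-tail (true  ∷ y) = n≤1+n _
  wt-tail (false ∷ y) = ≤-refl

  restore : ∀ {x x′} (z z′ : Output w (suc d) × Fin 1) → proj₁ z ◁ extend x → proj₁ z′ ◁ extend x′ →
            (let (a , b , c) , k = z in (a , tail b , tail c) , k) ≡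
            (let (a , b , c) , k = z′ in (a , tail b , tail c) , k) → z ≡ z′
  restore ((_ , _ ∷ _ , _ ∷ _) , _) ((_ , _ ∷ _ , _ ∷ _) , _)
    (_ , b≤b ∷ _ , b≤b ∷ _) (_ , b≤b ∷ _ , b≤b ∷ _) refl = refl

shorten-to : ∀ {w d d′ t} → d ≤ d′ → Coding w d′ t 1 → Coding w d t 1
shorten-to d≤d′ = go (≤⇒≤′ d≤d′)
  where
  go : ∀ {w d d′ t} → d ≤′ d′ → Coding w d′ t 1 → Coding w d t 1
  go ≤′-refl     α = α
  go (≤′-step p) α = go p (shorten α)

-- Tables: a word is coded in binary, least significant digit first.

bits : ∀ n → ℕ → Word n
bits zero    c = []
bits (suc n) c = (c % 2 ≡ᵇ 1) ∷ bits n (c / 2)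

value : ∀ {n} → Word n → ℕ
value []      = 0
value (b ∷ x) = indicator b + 2 * value x

toInput : ∀ {w d} → ℕ → Input w d
toInput {w} {d} c = take w (bits (w + d) c) , drop w (bits (w + d) c)

fromInput : ∀ {w d} → Input w d → ℕ
fromInput (x , y) = value (x ++ y)

toOutput : ∀ {w d} → ℕ → Output w d
toOutput {w} {d} c = let y = bits (w + (d + d)) c in take w y , take d (drop w y) , drop d (drop w y)

fromOutput : ∀ {w d} → Output w d → ℕ
fromOutput (a , b , c) = value (a ++ b ++ c)

nth : ∀ {A : Set} → A → List A → ℕ → A
nth default []       _       = default
nth default (x ∷ xs) zero    = x
nth default (x ∷ xs) (suc i) = nth default xs i

position : ∀ {A : Set} → (A → Bool) → List A → ℕ
position p []       = 0
position p (x ∷ xs) = if p x then 0 else suc (position p xs)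

all-words? : ∀ {n} {P : Word n → Set} → (∀ x → Dec (P x)) → Dec (∀ x → P x)
all-words? {zero}  P? = map′ (λ p → λ { [] → p }) (λ p → p []) (P? [])
all-words? {suc n} P? = map′
  (λ { (p , q) (true ∷ x) → p x ; (p , q) (false ∷ x) → q x }) (λ p → p ∘ (true ∷_) , p ∘ (false ∷_))
  (all-words? (P? ∘ (true ∷_)) ×-dec all-words? (P? ∘ (false ∷_)))

all-inputs? : ∀ {w d} {P : Input w d → Set} → (∀ x → Dec (P x)) → Dec (∀ x → P x)
all-inputs? P? = map′ (λ p (x , y) → p x y) (λ p x y → p (x , y)) (all-words? λ x → all-words? λ y → P? (x , y))

-- Unlike toWitness, this reduces a check to a conversion problem, which Agda evaluates efficiently.
holds : ∀ {P : Set} (p? : Dec P) → does p? ≡ true → P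
holds (yes p) _ = p

_≟ʷ_ : ∀ {n} → DecidableEquality (Word n)
_≟ʷ_ = ≡-dec Bool._≟_

_≟ⁱ_ : ∀ {w d} → DecidableEquality (Input w d)
_≟ⁱ_ = Product.≡-dec _≟ʷ_ _≟ʷ_

_≟ᵒ_ : ∀ {w d} → DecidableEquality (Output w d)
_≟ᵒ_ = Product.≡-dec _≟ʷ_ _≟ⁱ_

_◁?_ : ∀ {w d} (z : Output w d) (x : Input w d) → Dec (z ◁ x)
(a , b , c) ◁? (x , y) = (a ⊑? x) ×-dec (b ⊑? y) ×-dec (c ⊑? y)

-- The label is stored in the binary digits above those of the output word.
module Tabulated (w d t k : ℕ) .{{_ : NonZero k}} (table : List ℕ) where

  size : ℕ
  size = 2 ^ (w + (d + d))

  private instance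
    size-nonZero : NonZero size
    size-nonZero = m^n≢0 2 (w + (d + d))

  entry : Input w d → Output w d × Fin k
  entry x = let c = nth 0 table (fromInput x) in toOutput c , (c / size) mod k

  -- A candidate left inverse of `entry`. With it, injectivity is checked input by input instead of
  -- over all pairs.
  unentry : Output w d × Fin k → Input w d
  unentry (z , i) = toInput (position (_≡ᵇ (fromOutput z + size * toℕ i)) table)

  Valid : Input w d → Set
  Valid x = unentry (entry x) ≡ x × proj₁ (entry x) ◁ x × weight (proj₁ (entry x)) ≤ t

  valid? : Dec (∀ x → Valid x)
  valid? = all-inputs? λ x → (unentry (entry x) ≟ⁱ x) ×-dec (proj₁ (entry x) ◁? x) ×-dec (weight (proj₁ (entry x)) ≤? t)

  tabulated : (∀ x → Valid x) → Coding w d t k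
  tabulated valid = record
    { code      = entry
    ; injective = λ {x} {x′} eq → trans (sym (proj₁ (valid x))) (trans (cong unentry eq) (proj₁ (valid x′)))
    ; dominated = proj₁ ∘ proj₂ ∘ valid
    ; bounded   = proj₂ ∘ proj₂ ∘ valid
    }

-- The words representing a right part; the budget is the weight left for the left part.
data Row : Set where
  single    : ℕ → Row
  quintuple : Vec ℕ 5 → Row

multiplicity budget : Row → ℕ
multiplicity (single _)    = 1
multiplicity (quintuple _) = 5
budget (single _)    = 3
budget (quintuple _) = 2

entries : (r : Row) → Vec ℕ (multiplicity r)
entries (single c)     = c ∷ []
entries (quintuple cs) = cs

componentCoding : (r : Row) → Coding 3 6 3 1 → Coding 3 6 2 5 → Coding 3 6 (budget r) (multiplicity r)
componentCoding (single _)    α β = α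
componentCoding (quintuple _) α β = β

_∈ᵇ_ : ∀ {n} → ℕ → Vec ℕ n → Bool
c ∈ᵇ []       = false
c ∈ᵇ (d ∷ ds) = (c ≡ᵇ d) ∨ (c ∈ᵇ ds)

module Family (w d : ℕ) (rows : List Row) where

  row : Input w d → Row
  row y = nth (single 0) rows (fromInput y)

  member : ∀ y → Fin (multiplicity (row y)) → Output w d
  member y k = toOutput (lookup (entries (row y)) k)

  owner : Output w d → Input w d
  owner u = toInput (position (λ r → fromOutput u ∈ᵇ entries r) rows)

  -- The first clause keeps the rows of different inputs disjoint, the second keeps the words within
  -- a row distinct. With budgets 3 and 2, a single may weigh at most `w` and a member of a
  -- quintuple at most `w + 1`.
  Valid : ∀ y → Fin (multiplicity (row y)) → Set
  Valid y k = owner (member y k) ≡ y × (∀ l → member y k ≡ member y l → k ≡ l) ×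
              member y k ◁ y × budget (row y) + weight (member y k) ≤ 3 + w

  valid? : Dec (∀ y k → Valid y k)
  valid? = all-inputs? λ y → Fin.all? λ k →
    (owner (member y k) ≟ⁱ y) ×-dec Fin.all? (λ l → (member y k ≟ᵒ member y l) →-dec (k Fin.≟ l)) ×-dec
    (member y k ◁? y) ×-dec (budget (row y) + weight (member y k) ≤? 3 + w)

  extended : Coding 3 6 3 1 → Coding 3 6 2 5 → (∀ y k → Valid y k) → Coding (3 + w) (6 + d) (3 + w) 1
  extended α β valid = amalgamate (budget ∘ row) (multiplicity ∘ row) member (λ y → componentCoding (row y) α β)
    member-injective (λ y k → proj₁ (proj₂ (proj₂ (valid y k)))) (λ y k → proj₂ (proj₂ (proj₂ (valid y k))))
    where
    member-injective : ∀ {y y′ k k′} → member y k ≡ member y′ k′ → (y , k) ≡ (y′ , k′)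
    member-injective {y} {y′} {k} {k′} eq
      with refl ← trans (sym (proj₁ (valid y k))) (trans (cong owner eq) (proj₁ (valid y′ k′)))
      = cong (y ,_) (proj₁ (proj₂ (valid y k)) k′ eq)

-- The tables were found as matchings in the bipartite graph between inputs and the words they dominate.

-- The 512 inputs fit among the 1 + 15 + 105 + 455 = 576 words of length 15 and weight at most 3.
weight3Table : List ℕ
weight3Table =
  0 ∷ 1 ∷ 2 ∷ 3 ∷ 4 ∷ 5 ∷ 6 ∷ 7 ∷ 8 ∷ 9 ∷ 10 ∷ 11 ∷ 12 ∷ 13 ∷ 14 ∷ 512 ∷ 16 ∷ 17 ∷ 18 ∷ 19 ∷ 20 ∷
  21 ∷ 22 ∷ 1024 ∷ 24 ∷ 25 ∷ 26 ∷ 513 ∷ 28 ∷ 1025 ∷ 514 ∷ 515 ∷ 32 ∷ 33 ∷ 34 ∷ 35 ∷ 36 ∷ 37 ∷ 38 ∷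
  2048 ∷ 40 ∷ 41 ∷ 42 ∷ 2049 ∷ 44 ∷ 516 ∷ 2050 ∷ 2051 ∷ 48 ∷ 49 ∷ 50 ∷ 1026 ∷ 52 ∷ 1028 ∷ 2052 ∷
  1027 ∷ 56 ∷ 520 ∷ 1032 ∷ 1033 ∷ 2056 ∷ 517 ∷ 518 ∷ 1540 ∷ 64 ∷ 65 ∷ 66 ∷ 67 ∷ 68 ∷ 69 ∷ 70 ∷
  4096 ∷ 72 ∷ 73 ∷ 74 ∷ 4097 ∷ 76 ∷ 4100 ∷ 4098 ∷ 4099 ∷ 80 ∷ 81 ∷ 82 ∷ 1040 ∷ 84 ∷ 4112 ∷ 1088 ∷
  1029 ∷ 88 ∷ 4104 ∷ 528 ∷ 529 ∷ 576 ∷ 4101 ∷ 1030 ∷ 4612 ∷ 96 ∷ 97 ∷ 98 ∷ 2080 ∷ 100 ∷ 4128 ∷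
  2112 ∷ 2053 ∷ 104 ∷ 544 ∷ 4160 ∷ 545 ∷ 2560 ∷ 4129 ∷ 2054 ∷ 2564 ∷ 112 ∷ 2064 ∷ 1056 ∷ 2065 ∷
  3072 ∷ 4113 ∷ 4102 ∷ 3076 ∷ 1536 ∷ 1057 ∷ 1034 ∷ 1544 ∷ 1036 ∷ 5124 ∷ 6148 ∷ 6160 ∷ 128 ∷ 129 ∷
  130 ∷ 131 ∷ 132 ∷ 133 ∷ 134 ∷ 8192 ∷ 136 ∷ 137 ∷ 138 ∷ 8193 ∷ 140 ∷ 8196 ∷ 8194 ∷ 8195 ∷ 144 ∷
  145 ∷ 146 ∷ 8208 ∷ 148 ∷ 1152 ∷ 8320 ∷ 8197 ∷ 152 ∷ 8200 ∷ 640 ∷ 641 ∷ 8704 ∷ 1153 ∷ 8198 ∷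
  8708 ∷ 160 ∷ 161 ∷ 162 ∷ 8224 ∷ 164 ∷ 2176 ∷ 10240 ∷ 2177 ∷ 168 ∷ 521 ∷ 522 ∷ 8321 ∷ 524 ∷ 2561 ∷
  546 ∷ 10244 ∷ 176 ∷ 9216 ∷ 1042 ∷ 3073 ∷ 1044 ∷ 9217 ∷ 1058 ∷ 9220 ∷ 536 ∷ 1537 ∷ 530 ∷ 8328 ∷
  532 ∷ 2568 ∷ 8712 ∷ 8720 ∷ 192 ∷ 193 ∷ 194 ∷ 8256 ∷ 196 ∷ 4224 ∷ 12288 ∷ 8257 ∷ 200 ∷ 4608 ∷
  4106 ∷ 577 ∷ 4108 ∷ 4225 ∷ 578 ∷ 12290 ∷ 208 ∷ 5120 ∷ 4114 ∷ 1089 ∷ 4116 ∷ 5121 ∷ 1090 ∷ 12292 ∷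
  1048 ∷ 4609 ∷ 8258 ∷ 8264 ∷ 580 ∷ 4232 ∷ 4616 ∷ 12304 ∷ 224 ∷ 6144 ∷ 2082 ∷ 2113 ∷ 2084 ∷ 6145 ∷
  2114 ∷ 8288 ∷ 552 ∷ 8705 ∷ 642 ∷ 6152 ∷ 548 ∷ 10248 ∷ 12296 ∷ 2592 ∷ 1072 ∷ 10241 ∷ 1154 ∷ 8272 ∷
  1060 ∷ 1168 ∷ 2192 ∷ 10256 ∷ 1064 ∷ 3080 ∷ 5128 ∷ 1120 ∷ 9224 ∷ 1184 ∷ 1568 ∷ 1600 ∷ 256 ∷ 257 ∷
  258 ∷ 259 ∷ 260 ∷ 261 ∷ 262 ∷ 16384 ∷ 264 ∷ 265 ∷ 266 ∷ 16385 ∷ 268 ∷ 16388 ∷ 16386 ∷ 16387 ∷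
  272 ∷ 273 ∷ 274 ∷ 16400 ∷ 276 ∷ 1280 ∷ 16640 ∷ 16389 ∷ 280 ∷ 16392 ∷ 768 ∷ 16393 ∷ 16896 ∷
  16401 ∷ 16390 ∷ 16898 ∷ 288 ∷ 289 ∷ 290 ∷ 16416 ∷ 292 ∷ 2304 ∷ 18432 ∷ 16417 ∷ 296 ∷ 2057 ∷
  2058 ∷ 769 ∷ 2060 ∷ 2305 ∷ 16418 ∷ 18434 ∷ 304 ∷ 17408 ∷ 2066 ∷ 1281 ∷ 2068 ∷ 16641 ∷ 1282 ∷
  17410 ∷ 2072 ∷ 16897 ∷ 770 ∷ 776 ∷ 16420 ∷ 16644 ∷ 16900 ∷ 16912 ∷ 320 ∷ 321 ∷ 322 ∷ 16448 ∷
  324 ∷ 4352 ∷ 20480 ∷ 16449 ∷ 328 ∷ 4105 ∷ 16394 ∷ 4353 ∷ 16396 ∷ 20481 ∷ 16450 ∷ 20482 ∷ 336 ∷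
  1041 ∷ 16402 ∷ 17409 ∷ 16404 ∷ 1092 ∷ 4354 ∷ 17412 ∷ 4120 ∷ 16408 ∷ 16642 ∷ 16456 ∷ 16452 ∷
  20484 ∷ 1288 ∷ 17424 ∷ 352 ∷ 2081 ∷ 4130 ∷ 18433 ∷ 4132 ∷ 2116 ∷ 2306 ∷ 18436 ∷ 2088 ∷ 4136 ∷
  2562 ∷ 2312 ∷ 772 ∷ 4360 ∷ 16648 ∷ 4384 ∷ 2096 ∷ 4144 ∷ 3074 ∷ 16464 ∷ 1284 ∷ 1296 ∷ 2320 ∷
  18448 ∷ 16424 ∷ 16904 ∷ 17416 ∷ 20496 ∷ 18440 ∷ 1312 ∷ 16672 ∷ 2368 ∷ 384 ∷ 385 ∷ 386 ∷ 16512 ∷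
  388 ∷ 8448 ∷ 24576 ∷ 16513 ∷ 392 ∷ 8201 ∷ 8202 ∷ 8449 ∷ 8204 ∷ 24577 ∷ 8322 ∷ 24578 ∷ 400 ∷
  8209 ∷ 8210 ∷ 16514 ∷ 8212 ∷ 1156 ∷ 8450 ∷ 8452 ∷ 8216 ∷ 648 ∷ 1538 ∷ 16520 ∷ 644 ∷ 24580 ∷
  8456 ∷ 24592 ∷ 416 ∷ 8225 ∷ 8226 ∷ 2178 ∷ 8228 ∷ 2180 ∷ 10242 ∷ 2208 ∷ 8232 ∷ 2184 ∷ 8706 ∷
  24584 ∷ 8324 ∷ 672 ∷ 8352 ∷ 8480 ∷ 8240 ∷ 16432 ∷ 9218 ∷ 8336 ∷ 16516 ∷ 16528 ∷ 8464 ∷ 3104 ∷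
  1160 ∷ 560 ∷ 656 ∷ 8736 ∷ 784 ∷ 16928 ∷ 9248 ∷ 896 ∷ 448 ∷ 4161 ∷ 4162 ∷ 12289 ∷ 4164 ∷ 8260 ∷
  4226 ∷ 4288 ∷ 584 ∷ 4168 ∷ 4610 ∷ 20488 ∷ 4228 ∷ 704 ∷ 8384 ∷ 16576 ∷ 1104 ∷ 4176 ∷ 5122 ∷ 4240 ∷
  4356 ∷ 4368 ∷ 16656 ∷ 1216 ∷ 1096 ∷ 592 ∷ 1552 ∷ 832 ∷ 4624 ∷ 1344 ∷ 4416 ∷ 8512 ∷ 2144 ∷ 4192 ∷
  6146 ∷ 16480 ∷ 2308 ∷ 4256 ∷ 16544 ∷ 6176 ∷ 2120 ∷ 608 ∷ 800 ∷ 4640 ∷ 2336 ∷ 10272 ∷ 18464 ∷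
  16704 ∷ 2128 ∷ 3088 ∷ 5136 ∷ 5152 ∷ 9232 ∷ 17440 ∷ 12320 ∷ 3136 ∷ 2576 ∷ 20512 ∷ 24608 ∷ 2624 ∷
  2240 ∷ 4672 ∷ 8768 ∷ 16960 ∷ []

-- There are only 1 + 15 + 105 = 121 words of length 15 and weight at most 2, so four labels would
-- give 484 pairs, too few for 512 inputs; five give 605.
weight2Table : List ℕ
weight2Table =
  0 ∷ 32768 ∷ 65536 ∷ 1 ∷ 98304 ∷ 32769 ∷ 2 ∷ 3 ∷ 131072 ∷ 65537 ∷ 32770 ∷ 512 ∷ 4 ∷ 33280 ∷
  66048 ∷ 32771 ∷ 16 ∷ 98305 ∷ 65538 ∷ 1024 ∷ 32772 ∷ 33792 ∷ 66560 ∷ 65539 ∷ 8 ∷ 98816 ∷ 131584 ∷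
  98307 ∷ 99328 ∷ 5 ∷ 6 ∷ 66050 ∷ 32 ∷ 131073 ∷ 98306 ∷ 131104 ∷ 65540 ∷ 2048 ∷ 34816 ∷ 131075 ∷
  32776 ∷ 67584 ∷ 100352 ∷ 9 ∷ 133120 ∷ 32773 ∷ 32774 ∷ 98818 ∷ 32784 ∷ 132096 ∷ 18 ∷ 98321 ∷ 20 ∷
  65541 ∷ 65542 ∷ 99330 ∷ 24 ∷ 32777 ∷ 10 ∷ 131586 ∷ 12 ∷ 516 ∷ 132098 ∷ 33296 ∷ 64 ∷ 32832 ∷
  131074 ∷ 131136 ∷ 98308 ∷ 4096 ∷ 36864 ∷ 98309 ∷ 65544 ∷ 69632 ∷ 102400 ∷ 65545 ∷ 135168 ∷
  131077 ∷ 98310 ∷ 69634 ∷ 65552 ∷ 17 ∷ 32786 ∷ 131089 ∷ 32788 ∷ 65601 ∷ 131078 ∷ 102402 ∷ 32792 ∷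
  98313 ∷ 32778 ∷ 135170 ∷ 32780 ∷ 33284 ∷ 66052 ∷ 66064 ∷ 32800 ∷ 33 ∷ 34 ∷ 98337 ∷ 36 ∷ 131105 ∷
  98338 ∷ 67586 ∷ 40 ∷ 131081 ∷ 65546 ∷ 100354 ∷ 65548 ∷ 98820 ∷ 133122 ∷ 544 ∷ 48 ∷ 98369 ∷
  131090 ∷ 98384 ∷ 131092 ∷ 1028 ∷ 33796 ∷ 100368 ∷ 131096 ∷ 520 ∷ 33288 ∷ 98832 ∷ 131588 ∷
  131600 ∷ 133136 ∷ 1536 ∷ 128 ∷ 32896 ∷ 65664 ∷ 131200 ∷ 131076 ∷ 8192 ∷ 40960 ∷ 32897 ∷ 98312 ∷
  73728 ∷ 106496 ∷ 65665 ∷ 139264 ∷ 98433 ∷ 98314 ∷ 40962 ∷ 98320 ∷ 32785 ∷ 65554 ∷ 131201 ∷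
  65556 ∷ 1025 ∷ 32898 ∷ 73730 ∷ 65560 ∷ 513 ∷ 131082 ∷ 106498 ∷ 98316 ∷ 66564 ∷ 139266 ∷ 8208 ∷
  65568 ∷ 32801 ∷ 32802 ∷ 2049 ∷ 32804 ∷ 34817 ∷ 131106 ∷ 2052 ∷ 32808 ∷ 33281 ∷ 65666 ∷ 131208 ∷
  131084 ∷ 34820 ∷ 67588 ∷ 33312 ∷ 32816 ∷ 33793 ∷ 98434 ∷ 65680 ∷ 98340 ∷ 99332 ∷ 132100 ∷ 40976 ∷
  98344 ∷ 66056 ∷ 98824 ∷ 73744 ∷ 100356 ∷ 106512 ∷ 139280 ∷ 98944 ∷ 65600 ∷ 65 ∷ 66 ∷ 131137 ∷
  68 ∷ 4097 ∷ 65602 ∷ 4100 ∷ 72 ∷ 66049 ∷ 98370 ∷ 131592 ∷ 65604 ∷ 36868 ∷ 69636 ∷ 576 ∷ 80 ∷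
  66561 ∷ 131138 ∷ 131152 ∷ 98372 ∷ 102404 ∷ 135172 ∷ 102416 ∷ 65608 ∷ 1032 ∷ 33800 ∷ 135184 ∷
  8196 ∷ 33344 ∷ 66112 ∷ 106560 ∷ 96 ∷ 67585 ∷ 131202 ∷ 98400 ∷ 131108 ∷ 133124 ∷ 40964 ∷ 2080 ∷
  131112 ∷ 2056 ∷ 34824 ∷ 66080 ∷ 73732 ∷ 98848 ∷ 131616 ∷ 139328 ∷ 98352 ∷ 98448 ∷ 131216 ∷ 1056 ∷
  106500 ∷ 33824 ∷ 66592 ∷ 1152 ∷ 66568 ∷ 99360 ∷ 132128 ∷ 131712 ∷ 34848 ∷ 33920 ∷ 66688 ∷ 34304 ∷
  256 ∷ 33024 ∷ 65792 ∷ 131328 ∷ 98560 ∷ 16384 ∷ 49152 ∷ 257 ∷ 131080 ∷ 81920 ∷ 114688 ∷ 33025 ∷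
  147456 ∷ 65793 ∷ 258 ∷ 49153 ∷ 131088 ∷ 65553 ∷ 98322 ∷ 98561 ∷ 98324 ∷ 131329 ∷ 33026 ∷ 81921 ∷
  98328 ∷ 98817 ∷ 65794 ∷ 114689 ∷ 260 ∷ 147457 ∷ 16386 ∷ 16400 ∷ 98336 ∷ 65569 ∷ 65570 ∷ 100353 ∷
  65572 ∷ 133121 ∷ 98562 ∷ 49154 ∷ 65576 ∷ 131585 ∷ 131330 ∷ 81922 ∷ 33028 ∷ 16388 ∷ 114690 ∷
  67616 ∷ 65584 ∷ 99329 ∷ 1026 ∷ 147458 ∷ 65796 ∷ 49156 ∷ 81924 ∷ 49168 ∷ 264 ∷ 33032 ∷ 65800 ∷
  81936 ∷ 114692 ∷ 114704 ∷ 147472 ∷ 768 ∷ 98368 ∷ 32833 ∷ 32834 ∷ 36865 ∷ 32836 ∷ 69633 ∷ 4098 ∷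
  147460 ∷ 32840 ∷ 102401 ∷ 514 ∷ 98568 ∷ 131140 ∷ 131336 ∷ 4104 ∷ 320 ∷ 32848 ∷ 132097 ∷ 33794 ∷
  272 ∷ 98564 ∷ 33040 ∷ 65808 ∷ 33088 ∷ 98376 ∷ 99336 ∷ 132104 ∷ 65856 ∷ 36872 ∷ 98624 ∷ 131392 ∷
  16448 ∷ 32864 ∷ 135169 ∷ 2050 ∷ 131168 ∷ 131332 ∷ 288 ∷ 33056 ∷ 100384 ∷ 131144 ∷ 67592 ∷
  100360 ∷ 133152 ∷ 133128 ∷ 4128 ∷ 36896 ∷ 49216 ∷ 131120 ∷ 98576 ∷ 131344 ∷ 69664 ∷ 1040 ∷
  102432 ∷ 135200 ∷ 81984 ∷ 69640 ∷ 16416 ∷ 49184 ∷ 114752 ∷ 81952 ∷ 147520 ∷ 33536 ∷ 66304 ∷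
  98432 ∷ 129 ∷ 130 ∷ 8193 ∷ 132 ∷ 40961 ∷ 8194 ∷ 139268 ∷ 136 ∷ 73729 ∷ 33282 ∷ 8200 ∷ 32900 ∷
  40968 ∷ 73736 ∷ 384 ∷ 144 ∷ 106497 ∷ 66562 ∷ 33808 ∷ 65668 ∷ 66576 ∷ 99344 ∷ 33152 ∷ 32904 ∷
  106504 ∷ 139272 ∷ 65920 ∷ 16392 ∷ 98688 ∷ 131456 ∷ 99456 ∷ 160 ∷ 139265 ∷ 34818 ∷ 32928 ∷ 98436 ∷
  65696 ∷ 98464 ∷ 8224 ∷ 65672 ∷ 49160 ∷ 81928 ∷ 40992 ∷ 114696 ∷ 73760 ∷ 106528 ∷ 2176 ∷ 32912 ∷
  132112 ∷ 2064 ∷ 139296 ∷ 34832 ∷ 114720 ∷ 147488 ∷ 132224 ∷ 147464 ∷ 640 ∷ 33408 ∷ 34944 ∷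
  66176 ∷ 67712 ∷ 100480 ∷ 147584 ∷ 192 ∷ 16385 ∷ 36866 ∷ 32960 ∷ 131204 ∷ 65728 ∷ 98496 ∷ 4160 ∷
  98440 ∷ 102408 ∷ 135176 ∷ 98880 ∷ 131264 ∷ 131648 ∷ 36928 ∷ 4224 ∷ 65616 ∷ 4112 ∷ 36880 ∷ 1088 ∷
  69648 ∷ 33856 ∷ 66624 ∷ 36992 ∷ 528 ∷ 99392 ∷ 132160 ∷ 69760 ∷ 69696 ∷ 102528 ∷ 135296 ∷ 99072 ∷
  65632 ∷ 131232 ∷ 65824 ∷ 2112 ∷ 98592 ∷ 34880 ∷ 67648 ∷ 133248 ∷ 131360 ∷ 100416 ∷ 133184 ∷
  8320 ∷ 102464 ∷ 41088 ∷ 73856 ∷ 131840 ∷ 67600 ∷ 135232 ∷ 8256 ∷ 106624 ∷ 41024 ∷ 139392 ∷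
  16512 ∷ 1280 ∷ 73792 ∷ 49280 ∷ 82048 ∷ 34048 ∷ 114816 ∷ 66816 ∷ 99584 ∷ 132352 ∷ []

-- The six words of length 5 and weight at most 1 are the singles; the ten words of weight 2 fill
-- the two quintuples exactly.
rows₁₂ : List Row
rows₁₂ =
  single 0 ∷ single 1 ∷ single 2 ∷ single 8 ∷ single 4 ∷ single 16 ∷
  quintuple (6 ∷ 10 ∷ 18 ∷ 12 ∷ 20 ∷ []) ∷ quintuple (3 ∷ 5 ∷ 9 ∷ 17 ∷ 24 ∷ []) ∷ []

-- All 1 + 10 + 45 = 56 words of length 10 and weight at most 2 are singles. The remaining 8 of the
-- 64 inputs receive quintuples of words of weight 3.
rows₂₄ : List Row
rows₂₄ =
  single 0 ∷ single 1 ∷ single 2 ∷ single 3 ∷ single 4 ∷ single 64 ∷ single 6 ∷ single 5 ∷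
  single 8 ∷ single 128 ∷ single 10 ∷ single 9 ∷ single 12 ∷ single 65 ∷ single 66 ∷ single 129 ∷
  single 16 ∷ single 256 ∷ single 18 ∷ single 17 ∷ single 20 ∷ single 257 ∷ single 258 ∷
  single 68 ∷ single 24 ∷ single 136 ∷ single 130 ∷ single 264 ∷ single 132 ∷ single 260 ∷
  single 72 ∷ quintuple (265 ∷ 145 ∷ 193 ∷ 321 ∷ 385 ∷ []) ∷ single 32 ∷ single 512 ∷ single 34 ∷
  single 33 ∷ single 36 ∷ single 513 ∷ single 514 ∷ single 516 ∷ single 40 ∷ single 520 ∷
  single 160 ∷ single 544 ∷ single 96 ∷ single 192 ∷ single 576 ∷
  quintuple (73 ∷ 137 ∷ 521 ∷ 97 ∷ 161 ∷ []) ∷ single 48 ∷ single 272 ∷ single 528 ∷ single 288 ∷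
  single 80 ∷ single 320 ∷ single 768 ∷ quintuple (261 ∷ 517 ∷ 49 ∷ 81 ∷ 273 ∷ []) ∷ single 144 ∷
  single 384 ∷ single 640 ∷ quintuple (131 ∷ 259 ∷ 515 ∷ 25 ∷ 41 ∷ []) ∷
  quintuple (28 ∷ 44 ∷ 76 ∷ 140 ∷ 268 ∷ []) ∷ quintuple (13 ∷ 21 ∷ 37 ∷ 69 ∷ 133 ∷ []) ∷
  quintuple (14 ∷ 22 ∷ 38 ∷ 70 ∷ 134 ∷ []) ∷ quintuple (7 ∷ 11 ∷ 19 ∷ 35 ∷ 67 ∷ []) ∷ []

-- Codings with twice as many vertices of degree 2 as of degree 1

abstract

  weight3Coding : Coding 3 6 3 1
  weight3Coding = tabulated (holds valid? refl)
    where open Tabulated 3 6 3 1 weight3Table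

  weight2Coding : Coding 3 6 2 5
  weight2Coding = tabulated (holds valid? refl)
    where open Tabulated 3 6 2 5 weight2Table

  weight4Coding : Coding 4 8 4 1
  weight4Coding = extended weight3Coding weight2Coding (holds valid? refl)
    where open Family 1 2 rows₁₂

  weight5Coding : Coding 5 10 5 1
  weight5Coding = extended weight3Coding weight2Coding (holds valid? refl)
    where open Family 2 4 rows₂₄

-- Induction in steps of 3. The values 4 and 5 are not sums of smaller admissible values, hence the
-- three base cases.
tripleCoding : ∀ w → 3 ≤ w → Coding w (w * 2) w 1
tripleCoding 3 _ = weight3Coding
tripleCoding 4 _ = weight4Coding
tripleCoding 5 _ = weight5Coding
tripleCoding (suc (suc (suc w@(suc (suc (suc _)))))) _ = product weight3Coding (tripleCoding w (s≤s (s≤s (s≤s z≤n))))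
tripleCoding 1 (s≤s ())
tripleCoding 2 (s≤s (s≤s ()))

-- From codings to domination mappings

spread : ∀ {A : Set} w {d} → Vec A (w + d) → Vec A (w + (d + d))
spread w x = take w x ++ drop w x ++ drop w x

map-spread : ∀ {A B : Set} (f : A → B) w {d} (x : Vec A (w + d)) → map f (spread w x) ≡ spread w (map f x)
map-spread f w x
  rewrite map-++ f (take w x) (drop w x ++ drop w x) | map-++ f (drop w x) (drop w x)
        | take-map f w x | drop-map f w x = refl

-- Each right vertex gets exactly one neighbour, so domination amounts to `φ x ⊑ spread w x`.
toDominationMapping : ∀ {w d t} → Coding w d t 1 → DominationMapping (w + d) (w + (d + d)) t
toDominationMapping {w} {d} {t} α = φ , φ-injective , φ-bounded , E , no-isolated , dominating
  where
  input : Word (w + d) → Input w d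
  input x = take w x , drop w x

  flatten : Output w d → Word (w + (d + d))
  flatten (a , b , c) = a ++ b ++ c

  flatten-injective : ∀ z z′ → flatten z ≡ flatten z′ → z ≡ z′
  flatten-injective (a , b , c) (a′ , b′ , c′) eq
    with refl , eq′ ← ++-injective a a′ eq
    with refl , refl ← ++-injective b b′ eq′ = refl

  φ : Word (w + d) → Word (w + (d + d))
  φ x = flatten (proj₁ (code α (input x)))

  φ-injective : Injective _≡_ _≡_ φ
  φ-injective {x} {x′} eq = take-drop-injective w x x′ (cong proj₁ inputs≡) (cong proj₂ inputs≡)
    where
    inputs≡ : input x ≡ input x′
    inputs≡ = injective α (cong₂ _,_ (flatten-injective _ _ eq) (Fin₁-unique _ _))

  φ-bounded : ∀ x → wt (φ x) ≤ t
  φ-bounded x = let a , b , c = proj₁ (code α (input x)) in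
    ≤-trans (≤-reflexive (trans (wt-++ a (b ++ c)) (cong (wt a +_) (wt-++ b c)))) (bounded α (input x))

  -- Spreading the list of left vertices themselves records, for each right vertex, the left vertex
  -- whose bit it carries.
  source : Vec (Fin (w + d)) (w + (d + d))
  source = spread w (allFin (w + d))

  E : BipGraph (w + d) (w + (d + d))
  E i j = does (lookup source j Fin.≟ i)

  no-isolated : IsDominationGraph E
  no-isolated j = lookup source j , dec-true (lookup source j Fin.≟ lookup source j) refl

  φ-⊑ : ∀ x → φ x ⊑ spread w x
  φ-⊑ x = let p , q , r = dominated α (input x) in ++⁺ p (++⁺ q r)

  lookup-spread : ∀ x j → lookup (spread w x) j ≡ lookup x (lookup source j)
  lookup-spread x j = begin
    lookup (spread w x) j                                  ≡⟨ cong (λ y → lookup (spread w y) j) (map-lookup-allFin x) ⟨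
    lookup (spread w (map (lookup x) (allFin (w + d)))) j  ≡⟨ cong (λ y → lookup y j) (map-spread (lookup x) w (allFin (w + d))) ⟨
    lookup (map (lookup x) source) j                       ≡⟨ lookup-map j (lookup x) source ⟩
    lookup x (lookup source j)                             ∎
    where open ≡-Reasoning

  dominating : IsDominating E φ
  dominating x i j edge xi≡0 with refl ← holds (lookup source j Fin.≟ i) edge =
    ⊑⇒lookup (φ-⊑ x) j (trans (lookup-spread x j) xi≡0)

theorem11 : ∀ (m w : ℕ) → 3 ≤ w → w ≤ m → m ≤ 3 * w → IsNu m w ((m + m) ∸ w)
theorem11 m w 3≤w w≤m m≤3w = existence , minimality
  where
  d : ℕ
  d = m ∸ w

  w+d≡m : w + d ≡ m
  w+d≡m = m+[n∸m]≡n w≤m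

  d≤w*2 : d ≤ w * 2
  d≤w*2 = ≤-trans (∸-monoˡ-≤ w m≤3w) (≤-reflexive (trans (m+n∸m≡n w (2 * w)) (*-comm 2 w)))

  length≡ : w + (d + d) ≡ (m + m) ∸ w
  length≡ = begin
    w + (d + d)            ≡⟨ m+n∸m≡n w (w + (d + d)) ⟨
    w + (w + (d + d)) ∸ w  ≡⟨ cong (_∸ w) (regroup w d) ⟩
    w + d + (w + d) ∸ w    ≡⟨ cong (λ a → a + a ∸ w) w+d≡m ⟩
    m + m ∸ w              ∎
    where
    open ≡-Reasoning
    regroup : ∀ a b → a + (a + (b + b)) ≡ a + b + (a + b)
    regroup = solve-∀

  existence : DominationMapping m ((m + m) ∸ w) w
  -- Start from 2w vertices of degree 2 and drop all but m - w of them, which is possible because m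
  -- ≤ 3w.
  existence = subst₂ (λ a b → DominationMapping a b w) w+d≡m length≡
    (toDominationMapping (shorten-to d≤w*2 (tripleCoding w 3≤w)))

  minimality : ∀ n → DominationMapping m n w → (m + m) ∸ w ≤ n
  minimality n μ = m≤n+o⇒m∸n≤o (m + m) w (≤-trans (lower-bound μ) (≤-reflexive (+-comm n w)))
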